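{- With respect to the class of all frames that are forward and downward confluent, neither the class of all backward confluent frames nor the class of all upward confluent frames is modally definable.
   Context: Syntax. $\mathbf{At}=\{p_i : i\in\mathbb{N}\}$ is a countable set of atoms (enumerated without repetition). The set $\mathbf{Fo}$ of formulas is generated by $A ::= p \mid (A\rightharpoonup A)\mid (A\leftharpoondown A)\mid \top\mid\bot\mid (A\vee A)\mid (A\wedge A)\mid \lozenge A\mid\square A\mid⧫ A\mid\blacksquare A$, with $p\in\mathbf{At}$. A signed formula is a pair $(\alpha,A)$ with $\alpha\in\{+,-\}$ and $A\in\mathbf{Fo}$. Semantics. A frame is a triple $(W,\leq,R)$ where $W\neq\emptyset$, $\leq$ is a preorder on $W$ and $R$ is a binary relation on $W$; $\geq$ is the converse of $\leq$. A valuation is a function $V:\mathbf{At}\to\wp(W)$ such that each $V(p)$ is $\leq$-closed (if $s\in V(p)$ and $s\leq t$ then $t\in V(p)$). A model based on $(W,\leq,R)$ is $(W,\leq,R,V)$ with $V$ a valuation. Satisfaction at $s\in W$: $s\models p$ iff $s\in V(p)$; $s\models\top$; $s\not\models\bot$; $\vee,\wedge$ as usual pointwise; - $s\models A\rightharpoonup B$ iff for all $t\geq s$, $t\not\models A$ or $t\models B$; - $s\models A\leftharpoondown B$ iff there is $t\leq s$ with $t\not\models A$ and $t\models B$; - $s\models\lozenge A$ iff there are $t\leq s$ and $u$ with $tRu$ and $u\models A$; - $s\models\square A$ iff for all $t\geq s$ and all $u$, $tRu$ implies $u\models A$; - $s\models⧫ A$ iff for all $t\geq s$ there is $u$ with $tRu$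 and $u\models A$; - $s\models\blacksquare A$ iff there is $t\leq s$ such that for all $u$, $tRu$ implies $u\models A$. Further, $s\models(+,A)$ iff $s\models A$, and $s\models(-,A)$ iff $s\not\models A$. A signed formula is valid in a frame if it is satisfied at every point of every model based on the frame. Composition: $s(R\circ S)t$ iff there is $u$ with $sRu$ and $uSt$. A frame is forward confluent if ${\geq}\circ R\subseteq R\circ{\geq}$; backward confluent if $R\circ{\leq}\subseteq{\leq}\circ R$; downward confluent if ${\leq}\circ R\subseteq R\circ{\leq}$; upward confluent if $R\circ{\geq}\subseteq{\geq}\circ R$. Definability. An inference rule consists of $m\in\mathbb{N}$ signed formulas $(\alpha_1,A_1),\dots,(\alpha_m,A_m)$ (premises) and a signed formula $(\beta,B)$ (conclusion). A frame respects the rule if: whenever all premises are valid in the frame, the conclusion is valid in the frame. A class $\mathcal{C}$ of frames is modally definable with respect to a class $\mathcal{D}$ of frames if there is an inference rule such that every frame in $\mathcal{D}$ respects the rule iff it is in $\mathcal{C}$. -}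

module Defs where

open import Data.Empty.Polymorphic using (⊥)
open import Data.List.Base using (List)
open import Data.List.Relation.Unary.All using (All)
open import Data.Nat.Base using (ℕ)
open import Data.Product.Base using (_×_; ∃-syntax; _,_)
open import Data.Sign.Base using (Sign; +; -)
open import Data.Sum.Base using (_⊎_)
open import Data.Unit.Polymorphic using (⊤)
open import Function.Base using (flip)
open import Function.Bundles using (_⇔_)
open import Level using (Level; suc; _⊔_)
open import Relation.Binary.Construct.Composition using (_;_)
open import Relation.Binary.Core using (Rel; _⇒_)
open import Relation.Binary.Definitions using (_Respects_)
open import Relation.Binary.PropositionalEquality.Core using (_≡_)
open import Relation.Binary.Structures using (IsPreorder)
open import Relation.Nullary.Negation.Core using (¬_)
open import Relation.Unary using (Pred)

infixr 5 _⇀_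
infixl 5 _↽_
infixr 6 _∨_
infixr 7 _∧_
infix  8 ◇_ □_ ◆_ ■_

data Formula : Set where
  atom        : ℕ → Formula
  _⇀_ _↽_     : Formula → Formula → Formula
  top bot     : Formula
  _∨_ _∧_     : Formula → Formula → Formula
  ◇_ □_ ◆_ ■_ : Formula → Formula

SignedFormula : Set
SignedFormula = Sign × Formula

record Frame (ℓ : Level) : Set (suc ℓ) where
  infix 4 _≤_ _≥_
  field
    W          : Set ℓ
    -- Double negation keeps non-emptiness a mere property: a frame does not
    -- come with a distinguished point.
    nonEmpty   : ¬ ¬ W
    _≤_        : Rel W ℓ
    isPreorder : IsPreorder _≡_ _≤_
    R          : Rel W ℓ

  _≥_ : Rel W ℓ
  _≥_ = flip _≤_

record Valuation {ℓ : Level} (F : Frame ℓ) : Set (suc ℓ) where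
  open Frame F
  field
    V      : ℕ → Pred W ℓ
    closed : ∀ p → V p Respects _≤_

module _ {ℓ : Level} (F : Frame ℓ) (𝒱 : Valuation F) where
  open Frame F
  open Valuation 𝒱

  infix 4 _⊨_ _⊨±_

  -- The clause for ⇀ is the pointwise disjunction "t ⊭ A or t ⊨ B", which
  -- constructively is stronger than the implication t ⊨ A → t ⊨ B.
  _⊨_ : W → Formula → Set ℓ
  s ⊨ atom p  = V p s
  s ⊨ (A ⇀ B) = ∀ t → t ≥ s → (¬ (t ⊨ A)) ⊎ (t ⊨ B)
  s ⊨ (A ↽ B) = ∃[ t ] t ≤ s × (¬ (t ⊨ A)) × (t ⊨ B)
  s ⊨ top     = ⊤
  s ⊨ bot     = ⊥
  s ⊨ (A ∨ B) = (s ⊨ A) ⊎ (s ⊨ B)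
  s ⊨ (A ∧ B) = (s ⊨ A) × (s ⊨ B)
  s ⊨ (◇ A)   = ∃[ t ] ∃[ u ] t ≤ s × R t u × (u ⊨ A)
  s ⊨ (□ A)   = ∀ t → t ≥ s → ∀ u → R t u → u ⊨ A
  s ⊨ (◆ A)   = ∀ t → t ≥ s → ∃[ u ] R t u × (u ⊨ A)
  s ⊨ (■ A)   = ∃[ t ] t ≤ s × (∀ u → R t u → u ⊨ A)

  _⊨±_ : W → SignedFormula → Set ℓ
  s ⊨± (+ , A) = s ⊨ A
  s ⊨± (- , A) = ¬ (s ⊨ A)

Valid : {ℓ : Level} → Frame ℓ → SignedFormula → Set (suc ℓ)
Valid F φ = ∀ (𝒱 : Valuation F) (s : Frame.W F) → _⊨±_ F 𝒱 s φ

module _ {ℓ : Level} where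

  ForwardConfluent BackwardConfluent DownwardConfluent UpwardConfluent
    : Pred (Frame ℓ) ℓ
  ForwardConfluent  F = let open Frame F in (_≥_ ; R) ⇒ (R ; _≥_)
  BackwardConfluent F = let open Frame F in (R ; _≤_) ⇒ (_≤_ ; R)
  DownwardConfluent F = let open Frame F in (_≤_ ; R) ⇒ (R ; _≤_)
  UpwardConfluent   F = let open Frame F in (R ; _≥_) ⇒ (_≥_ ; R)

record InferenceRule : Set where
  field
    premises   : List SignedFormula
    conclusion : SignedFormula

RespectsRule : {ℓ : Level} → Frame ℓ → InferenceRule → Set (suc ℓ)
RespectsRule F ρ = All (Valid F) premises → Valid F conclusion
  where open InferenceRule ρ

ModallyDefinable_WithRespectTo_ :
  {ℓ c d : Level} → Pred (Frame ℓ) c → Pred (Frame ℓ) d → Set (suc ℓ ⊔ c ⊔ d)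
ModallyDefinable 𝒞 WithRespectTo 𝒟 =
  ∃[ ρ ] ∀ F → 𝒟 F → (RespectsRule F ρ ⇔ 𝒞 F)

{-# OPTIONS --safe #-}

-- Truth is preserved along ≤, so ◇ and ◆ see only the relation R ; ≥, while □
-- and ■ see only R ; ≤. Two relations on one preorder that agree after
-- composition with ≥ and with ≤ therefore validate the same signed formulas.
-- Take two worlds, each below the other: the relation that reaches only one of
-- them and the total relation agree in this sense, and both are forward and
-- downward confluent, but only the total one is backward and upward confluent.
module Submission where

open import Defs
open import Data.Bool.Base using (Bool; true; false)
open import Data.List.Relation.Unary.All as All using ()
open import Data.Product.Base using (_×_; _,_; proj₁; proj₂)
open import Data.Sign.Base using (+; -)
open import Data.Sum.Base as Sum using (inj₁; inj₂)
open import Data.Unit.Polymorphic using (⊤; tt)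
open import Function.Base using (_∘_)
open import Function.Bundles using (module Equivalence)
open import Level using (Level; Lift; lift)
open import Relation.Binary.Construct.Composition using (_;_)
open import Relation.Binary.Core using (Rel; _⇒_)
open import Relation.Binary.PropositionalEquality.Core using (_≡_; refl)
open import Relation.Binary.PropositionalEquality.Properties using (isEquivalence)
open import Relation.Binary.Structures using (IsPreorder)
open import Relation.Nullary.Negation.Core using (¬_)
open import Relation.Unary using (Pred; _∩_)

private
  variable
    ℓ c d : Level

module _ (F : Frame ℓ) (𝒱 : Valuation F) where
  open Frame F
  open IsPreorder isPreorder using (trans)

  -- The clauses for implications and modalities ask about all worlds above `s` or some world below
  -- `s`, so transitivity carries them upward; only `∨` and `∧` recurse.
  ⊨-persistent : ∀ A {s t} → s ≤ t → _⊨_ F 𝒱 s A → _⊨_ F 𝒱 t A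
  ⊨-persistent (atom p) s≤t sA = Valuation.closed 𝒱 p s≤t sA
  ⊨-persistent (A ⇀ B)  s≤t sA = λ u t≤u → sA u (trans s≤t t≤u)
  ⊨-persistent (A ↽ B)  s≤t (u , u≤s , u⊭A , uB) = u , trans u≤s s≤t , u⊭A , uB
  ⊨-persistent top      s≤t sA = sA
  ⊨-persistent (A ∨ B)  s≤t sA = Sum.map (⊨-persistent A s≤t) (⊨-persistent B s≤t) sA
  ⊨-persistent (A ∧ B)  s≤t (sA , sB) = ⊨-persistent A s≤t sA , ⊨-persistent B s≤t sB
  ⊨-persistent (◇ A)    s≤t (u , v , u≤s , uRv , vA) = u , v , trans u≤s s≤t , uRv , vA
  ⊨-persistent (□ A)    s≤t sA = λ u t≤u → sA u (trans s≤t t≤u)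
  ⊨-persistent (◆ A)    s≤t sA = λ u t≤u → sA u (trans s≤t t≤u)
  ⊨-persistent (■ A)    s≤t (u , u≤s , uA) = u , trans u≤s s≤t , uA

module _ (F : Frame ℓ) where
  open Frame F hiding (R)

  withRelation : Rel W ℓ → Frame ℓ
  withRelation R = record { Frame F hiding (R) ; R = R }

  withRelation-valuation : ∀ {R} R′ → Valuation (withRelation R) → Valuation (withRelation R′)
  withRelation-valuation R′ 𝒱 = record { Valuation 𝒱 }

  -- Since `≤` is a preorder, this amounts to `R ; _≥_` lying in `R′ ; _≥_` and `R ; _≤_` lying in
  -- `R′ ; _≤_`.
  _≲_ : Rel (Rel W ℓ) ℓ
  R ≲ R′ = (R ⇒ (R′ ; _≥_)) × (R ⇒ (R′ ; _≤_))

  -- For `◇` and `◆` a witness is replaced by an `R′`-successor above it; for `□` and `■` a given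
  -- `R′`-successor has an `R`-successor below it. Persistence then moves truth upward.
  ⊨-transfer : ∀ {R R′} → R ≲ R′ → R′ ≲ R → (𝒱 : Valuation (withRelation R)) →
               ∀ A {s} → _⊨_ (withRelation R) 𝒱 s A →
               _⊨_ (withRelation R′) (withRelation-valuation R′ 𝒱) s A
  ⊨-transfer {R} {R′} R≲R′ R′≲R 𝒱 = to
    where
    𝒱′ = withRelation-valuation R′ 𝒱

    to : ∀ A {s} → _⊨_ (withRelation R) 𝒱 s A → _⊨_ (withRelation R′) 𝒱′ s A

    -- Antecedents of `⇀` and `↽` occur negatively and need the converse, which is the same lemma
    -- with the relations exchanged. Record eta identifies the valuation carried back with `𝒱`.
    from : ∀ A {s} → _⊨_ (withRelation R′) 𝒱′ s A → _⊨_ (withRelation R) 𝒱 s A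
    from = ⊨-transfer R′≲R R≲R′ 𝒱′

    to (atom p) sA = sA
    to (A ⇀ B)  sA = λ t s≤t → Sum.map (_∘ from A) (to B) (sA t s≤t)
    to (A ↽ B)  (t , t≤s , t⊭A , tB) = t , t≤s , t⊭A ∘ from A , to B tB
    to top      sA = sA
    to (A ∨ B)  sA = Sum.map (to A) (to B) sA
    to (A ∧ B)  (sA , sB) = to A sA , to B sB
    to (◇ A)    (t , u , t≤s , tRu , uA) =
      let v , tR′v , u≤v = proj₁ R≲R′ tRu
      in  t , v , t≤s , tR′v , ⊨-persistent (withRelation R′) 𝒱′ A u≤v (to A uA)
    to (□ A)    sA = λ t s≤t u tR′u →
      let v , tRv , v≤u = proj₂ R′≲R tR′u
      in  ⊨-persistent (withRelation R′) 𝒱′ A v≤u (to A (sA t s≤t v tRv))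
    to (◆ A)    sA = λ t s≤t →
      let u , tRu , uA = sA t s≤t
          v , tR′v , u≤v = proj₁ R≲R′ tRu
      in  v , tR′v , ⊨-persistent (withRelation R′) 𝒱′ A u≤v (to A uA)
    to (■ A)    (t , t≤s , tA) = t , t≤s , λ u tR′u →
      let v , tRv , v≤u = proj₂ R′≲R tR′u
      in  ⊨-persistent (withRelation R′) 𝒱′ A v≤u (to A (tA v tRv))

  Valid-transfer : ∀ {R R′} → R ≲ R′ → R′ ≲ R → ∀ φ →
                   Valid (withRelation R) φ → Valid (withRelation R′) φ
  Valid-transfer {R} R≲R′ R′≲R (+ , A) valid 𝒱 s =
    ⊨-transfer R≲R′ R′≲R (withRelation-valuation R 𝒱) A (valid _ s)
  Valid-transfer R≲R′ R′≲R (- , A) valid 𝒱 s sA =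
    valid _ s (⊨-transfer R′≲R R≲R′ 𝒱 A sA)

-- A rule sees a frame only through validity: premises valid in `G` are valid in `F`, which respects
-- the rule, and the conclusion passes back to `G`.
undefinable : {𝒞 : Pred (Frame ℓ) c} {𝒟 : Pred (Frame ℓ) d} {F G : Frame ℓ} →
              (∀ φ → Valid F φ → Valid G φ) → (∀ φ → Valid G φ → Valid F φ) →
              𝒟 F → 𝒟 G → 𝒞 F → ¬ 𝒞 G →
              ¬ (ModallyDefinable 𝒞 WithRespectTo 𝒟)
undefinable {F = F} {G} F⇒G G⇒F F∈𝒟 G∈𝒟 F∈𝒞 G∉𝒞 (ρ , defines) =
  G∉𝒞 (Equivalence.to (defines G G∈𝒟) λ premises →
    F⇒G (InferenceRule.conclusion ρ)
      (Equivalence.from (defines F F∈𝒟) F∈𝒞 (All.map (λ {φ} → G⇒F φ) premises)))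

module _ (ℓ : Level) where

  totalFrame : Frame ℓ
  totalFrame = record
    { W          = Lift ℓ Bool
    ; nonEmpty   = λ empty → empty (lift true)
    ; _≤_        = λ _ _ → ⊤
    -- The omitted reflexivity and transitivity take values in the unit type and are filled in by
    -- eta.
    ; isPreorder = record { isEquivalence = isEquivalence }
    ; R          = λ _ _ → ⊤
    }

  ToTrue : Rel (Lift ℓ Bool) ℓ
  ToTrue _ t = t ≡ lift true

  toTrueFrame : Frame ℓ
  toTrueFrame = withRelation totalFrame ToTrue

  total≲toTrue : _≲_ totalFrame (Frame.R totalFrame) ToTrue
  total≲toTrue = (λ _ → lift true , refl , tt) , (λ _ → lift true , refl , tt)

  toTrue≲total : _≲_ totalFrame ToTrue (Frame.R totalFrame)
  toTrue≲total = (λ _ → lift true , tt , tt) , (λ _ → lift true , tt , tt)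

  total-confluent : (ForwardConfluent ∩ DownwardConfluent) totalFrame
  total-confluent = (λ _ → lift true , tt , tt) , (λ _ → lift true , tt , tt)

  toTrue-confluent : (ForwardConfluent ∩ DownwardConfluent) toTrueFrame
  toTrue-confluent = (λ _ → lift true , refl , tt) , (λ _ → lift true , refl , tt)

  -- `lift false` lies above the successor `lift true`, so confluence would make it a successor
  -- itself. It also lies below `lift true`, which refutes upward confluence in the same way.
  toTrue-¬backward : ¬ BackwardConfluent toTrueFrame
  toTrue-¬backward backward
    with backward {lift true} {lift false} (lift true , refl , tt)
  ... | _ , _ , ()

  toTrue-¬upward : ¬ UpwardConfluent toTrueFrame
  toTrue-¬upward upward
    with upward {lift true} {lift false} (lift true , refl , tt)
  ... | _ , _ , ()

  undefinable-if-separated : (𝒞 : Pred (Frame ℓ) c) → 𝒞 totalFrame → ¬ 𝒞 toTrueFrame →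
    ¬ (ModallyDefinable 𝒞 WithRespectTo (ForwardConfluent ∩ DownwardConfluent))
  undefinable-if-separated 𝒞 = undefinable {𝒞 = 𝒞}
    (Valid-transfer totalFrame total≲toTrue toTrue≲total)
    (Valid-transfer totalFrame toTrue≲total total≲toTrue)
    total-confluent toTrue-confluent

proposition29 : (ℓ : Level) →
    let 𝒟 = ForwardConfluent {ℓ} ∩ DownwardConfluent in
    (¬ (ModallyDefinable BackwardConfluent WithRespectTo 𝒟))
    × (¬ (ModallyDefinable UpwardConfluent WithRespectTo 𝒟))
proposition29 ℓ =
    undefinable-if-separated ℓ BackwardConfluent (λ _ → lift true , tt , tt) (toTrue-¬backward ℓ)
  , undefinable-if-separated ℓ UpwardConfluent (λ _ → lift true , tt , tt) (toTrue-¬upward ℓ)
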